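{- Let $A$ be a finite alphabet. The coloured non-commutative elementary symmetric functions satisfy, for all sentences $I,J$ over $A$, $$E_I\cdot E_J=E_{I\cdot J}$$ in $\mathrm{NSym}_A$. In particular, the elementary symmetric functions $E_I$ are generated by the single-word elementary functions $E_{(w)}$.
   Context: $\Bbbk$ is a field of characteristic zero. A sentence $I=(w_1,\dots,w_m)$ over $A$ is a finite sequence of non-empty words in letters of $A$; $1$ is the empty sentence. $\ell(I)=m$ is its length and $|I|=|w_1|+\dots+|w_m|$ its size (total number of letters). $I\cdot J$ is the concatenation of the two sequences of words. Write $J\preccurlyeq I$ ($J$ refines $I$) if the words of $I$ can be obtained by concatenating adjacent words of $J$. $\mathrm{NSym}_A$ is the $\Bbbk$-algebra with linear basis $(H_I)$ indexed by sentences over $A$, with product $H_I\cdot H_J=H_{I\cdot J}$ and unit $H_1=1$. The coloured non-commutative elementary symmetric functions are $$E_I=\sum_{J\preccurlyeq I}(-1)^{|I|-\ell(J)}H_J .$$ -}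

module Defs where

open import Level using (Level; _⊔_)
open import Algebra.Apartness.Bundles using (HeytingField; HeytingCommutativeRing)
open import Algebra.Bundles using (CommutativeRing)
import Algebra.Properties.Semiring.Exp as Exp
import Algebra.Properties.Semiring.Mult as Mult
open import Data.Empty using (⊥-elim)
open import Data.Fin.Base using (Fin)
open import Data.Fin.Properties using (inj⇒≟)
open import Data.List.Base
  using (List; []; _∷_; [_]; _++_; map; concat; foldr; length; sum; cartesianProductWith)
open import Data.List.Membership.Propositional using (_∈_)
open import Data.List.Membership.Propositional.Properties
  using (∈-map⁺; ∈-map⁻; ∈-++⁺ˡ; ∈-++⁺ʳ; ∈-++⁻; ∈-cartesianProductWith⁺; ∈-cartesianProductWith⁻)
open import Data.List.NonEmpty.Base as List⁺ using (List⁺; _∷_; _∷⁺_; toList)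
open import Data.List.Properties
  using (≡-dec; ∷-injective; ∷-injectiveˡ; ∷-injectiveʳ; ++-cancelˡ)
open import Data.List.Relation.Unary.All as All using ([]; _∷_)
open import Data.List.Relation.Unary.Any using (here)
open import Data.List.Relation.Unary.Unique.Propositional using (Unique; []; _∷_)
import Data.List.Relation.Unary.Unique.Propositional.Properties as Unique
open import Data.Nat.Base as ℕ using (ℕ; _∸_)
open import Data.Product.Base using (Σ; ∃-syntax; _×_; _,_; proj₂)
open import Data.Sum.Base using (inj₁; inj₂)
open import Function.Bundles using (_↔_; _⇔_; mk⇔)
open import Function.Properties.Inverse using (↔⇒↣)
open import Relation.Binary.Core using (Rel)
open import Relation.Binary.Definitions using (DecidableEquality)
open import Relation.Binary.PropositionalEquality.Core
  using (_≡_; _≢_; refl; sym; trans; cong; cong₂)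
open import Relation.Nullary.Decidable using (yes; no; map′)
open import Relation.Nullary.Negation using (¬_)
open import Relation.Unary using (Pred)

private
  variable
    a c ℓ₁ ℓ₂ p : Level

Finite : Set a → Set a
Finite A = ∃[ n ] (A ↔ Fin n)

CharacteristicZero : HeytingField c ℓ₁ ℓ₂ → Set ℓ₁
CharacteristicZero 𝕜 = ∀ n → .{{ℕ.NonZero n}} → ¬ (n · 1# ≈ 0#)
  where
  open HeytingField 𝕜 using (_≈_; 0#; 1#; heytingCommutativeRing)
  open CommutativeRing (HeytingCommutativeRing.commutativeRing heytingCommutativeRing)
    using (semiring)
  open Mult semiring using () renaming (_×_ to _·_)

Word : Set a → Set a
Word A = List⁺ A

-- The product I · J of sentences is _++_, and ℓ(I) is length I.
Sentence : Set a → Set a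
Sentence A = List (Word A)

module _ {A : Set a} where

  size : Sentence A → ℕ
  size I = sum (map List⁺.length I)

  -- K cuts J into non-empty blocks of adjacent words, and I is obtained by
  -- concatenating the words of each block.
  infix 4 _≼_
  _≼_ : Rel (Sentence A) a
  J ≼ I = Σ (List (List⁺ (Word A))) λ K →
            J ≡ concat (map toList K) × I ≡ map List⁺.concat K

  prependLetter : A → Sentence A → Sentence A
  prependLetter x []      = []
  prependLetter x (v ∷ J) = (x ∷⁺ v) ∷ J

  -- All sentences whose concatenation is the word x ∷ xs.
  factorisations : A → List A → List (Sentence A)
  factorisations x []       = [ [ List⁺.[ x ] ] ]
  factorisations x (y ∷ xs) =
    map (List⁺.[ x ] ∷_) (factorisations y xs) ++
    map (prependLetter x) (factorisations y xs)

  -- By ∈-refinements and refinements-unique below, this lists every J ≼ I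
  -- exactly once.
  refinements : Sentence A → List (Sentence A)
  refinements []             = [ [] ]
  refinements ((x ∷ xs) ∷ I) =
    cartesianProductWith _++_ (factorisations x xs) (refinements I)

  private

    letters : Sentence A → List A
    letters J = concat (map toList J)

    fact-sound : ∀ x xs {J} → J ∈ factorisations x xs → letters J ≡ x ∷ xs
    fact-sound x [] (here refl) = refl
    fact-sound x (y ∷ xs) J∈
      with ∈-++⁻ (map (List⁺.[ x ] ∷_) (factorisations y xs)) J∈
    ... | inj₁ J∈ˡ with ∈-map⁻ _ J∈ˡ
    ...   | J′ , J′∈ , refl = cong (x ∷_) (fact-sound y xs J′∈)
    fact-sound x (y ∷ xs) J∈ | inj₂ J∈ʳ with ∈-map⁻ _ J∈ʳ
    ...   | (v ∷ J′) , J′∈ , refl = cong (x ∷_) (fact-sound y xs J′∈)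
    ...   | [] , J′∈ , refl with () ← fact-sound y xs J′∈

    fact-complete : ∀ x xs J → letters J ≡ x ∷ xs → J ∈ factorisations x xs
    fact-complete x [] ((.x ∷ []) ∷ []) refl = here refl
    fact-complete x [] ((z ∷ []) ∷ (v ∷ J)) eq with () ← ∷-injectiveʳ eq
    fact-complete x [] ((z ∷ z′ ∷ zs) ∷ J) eq with () ← ∷-injectiveʳ eq
    fact-complete x (y ∷ xs) ((z ∷ []) ∷ J) eq with ∷-injective eq
    ... | refl , eq′ = ∈-++⁺ˡ (∈-map⁺ _ (fact-complete y xs J eq′))
    fact-complete x (y ∷ xs) ((z ∷ z′ ∷ zs) ∷ J) eq with ∷-injective eq
    ... | refl , eq′ =
      ∈-++⁺ʳ (map (List⁺.[ x ] ∷_) (factorisations y xs))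
        (∈-map⁺ (prependLetter x) (fact-complete y xs ((z′ ∷ zs) ∷ J) eq′))

    block : ∀ x xs J → letters J ≡ x ∷ xs →
            ∃[ k ] (J ≡ toList k × (x ∷ xs) ≡ List⁺.concat k)
    block x xs (v ∷ J) eq = (v ∷ J) , refl ,
      cong₂ _∷_ (sym (∷-injectiveˡ eq)) (sym (∷-injectiveʳ eq))

    ref-sound : ∀ I {J} → J ∈ refinements I → J ≼ I
    ref-sound [] (here refl) = [] , refl , refl
    ref-sound ((x ∷ xs) ∷ I) J∈
      with ∈-cartesianProductWith⁻ _++_ (factorisations x xs) (refinements I) J∈
    ... | J₁ , J₂ , J₁∈ , J₂∈ , refl
      with block x xs J₁ (fact-sound x xs J₁∈) | ref-sound I J₂∈
    ... | k , refl , eq | K , refl , eq′ = k ∷ K , refl , cong₂ _∷_ eq eq′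

    ref-complete : ∀ I {J} → J ≼ I → J ∈ refinements I
    ref-complete _ ([] , refl , refl) = here refl
    ref-complete _ (k ∷ K , refl , refl) =
      ∈-cartesianProductWith⁺ _++_
        (fact-complete _ _ (toList k) refl)
        (ref-complete _ (K , refl , refl))

    prepend-unique : ∀ x (Js : List (Sentence A)) → All.All (_≢ []) Js →
                     Unique Js → Unique (map (prependLetter x) Js)
    prepend-unique x [] _ [] = []
    prepend-unique x (J ∷ Js) (J≢[] ∷ ne) (J∉ ∷ u) =
      All.tabulate distinct ∷ prepend-unique x Js ne u
      where
      injective : ∀ {J J′} → J ≢ [] → J′ ≢ [] →
                  prependLetter x J ≡ prependLetter x J′ → J ≡ J′
      injective {[]}    {_}     p _ _ = ⊥-elim (p refl)
      injective {_ ∷ _} {[]}    _ q _ = ⊥-elim (q refl)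
      injective {_ ∷ _} {_ ∷ _} _ _ refl = refl

      distinct : ∀ {J′} → J′ ∈ map (prependLetter x) Js → prependLetter x J ≢ J′
      distinct J′∈ eq with ∈-map⁻ (prependLetter x) J′∈
      ... | J″ , J″∈ , refl =
        All.lookup J∉ J″∈ (injective J≢[] (All.lookup ne J″∈) eq)

    fact-nonempty : ∀ x xs → All.All (_≢ []) (factorisations x xs)
    fact-nonempty x xs = All.tabulate nonempty
      where
      nonempty : ∀ {J} → J ∈ factorisations x xs → J ≢ []
      nonempty J∈ refl with () ← fact-sound x xs J∈

    fact-unique : ∀ x xs → Unique (factorisations x xs)
    fact-unique x []       = [] ∷ []
    fact-unique x (y ∷ xs) = Unique.++⁺
      (Unique.map⁺ ∷-injectiveʳ (fact-unique y xs))
      (prepend-unique x _ (fact-nonempty y xs) (fact-unique y xs))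
      disjoint
      where
      disjoint : ∀ {J} → ¬ (J ∈ map (List⁺.[ x ] ∷_) (factorisations y xs) ×
                            J ∈ map (prependLetter x) (factorisations y xs))
      disjoint (p , q) with ∈-map⁻ _ p | ∈-map⁻ _ q
      ... | _ , _ , refl | [] , J∈ , ()
      ... | _ , _ , refl | (_ ∷ _) , J∈ , ()

    ++-split : ∀ (I I′ {J J′} : Sentence A) → letters I ≡ letters I′ →
               I ++ J ≡ I′ ++ J′ → I ≡ I′
    ++-split []      []        _ _ = refl
    ++-split (v ∷ I) (v′ ∷ I′) eq eq′ with ∷-injective eq′
    ... | refl , eq″ = cong (v ∷_)
      (++-split I I′ (++-cancelˡ (toList v) _ _ eq) eq″)

    product-unique : ∀ {w} Is {Js : List (Sentence A)} →
                     All.All (λ I → letters I ≡ w) Is → Unique Is → Unique Js →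
                     Unique (cartesianProductWith _++_ Is Js)
    product-unique []       _          _        _  = []
    product-unique (I ∷ Is) {Js} (Iw ∷ Isw) (I∉ ∷ u) uJ = Unique.++⁺
      (Unique.map⁺ (++-cancelˡ I _ _) uJ)
      (product-unique Is Isw u uJ)
      disjoint
      where
      disjoint : ∀ {K} → ¬ (K ∈ map (I ++_) Js × K ∈ cartesianProductWith _++_ Is Js)
      disjoint (p , q) with ∈-map⁻ _ p | ∈-cartesianProductWith⁻ _++_ Is Js q
      ... | J , _ , refl | I′ , J′ , I′∈ , _ , eq =
        All.lookup I∉ I′∈
          (++-split I I′ (trans Iw (sym (All.lookup Isw I′∈))) eq)

  ∈-refinements : ∀ {I J} → J ∈ refinements I ⇔ J ≼ I
  ∈-refinements = mk⇔ (ref-sound _) (ref-complete _)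

  refinements-unique : ∀ I → Unique (refinements I)
  refinements-unique []             = [] ∷ []
  refinements-unique ((x ∷ xs) ∷ I) = product-unique (factorisations x xs)
    (All.tabulate (fact-sound x xs)) (fact-unique x xs) (refinements-unique I)

module NSym (𝕜 : HeytingField c ℓ₁ ℓ₂) (A : Set a) (finite : Finite A) where

  private
    module 𝕜 = HeytingField 𝕜
    open CommutativeRing (HeytingCommutativeRing.commutativeRing 𝕜.heytingCommutativeRing)
      using (semiring)
    open Exp semiring using (_^_)

  _≟_ : DecidableEquality (Sentence A)
  _≟_ = ≡-dec λ (x ∷ xs) (y ∷ ys) →
    map′ (λ { refl → refl }) (λ { refl → refl }) (≡-dec (inj⇒≟ (↔⇒↣ (proj₂ finite))) (x ∷ xs) (y ∷ ys))

  -- The free 𝕜-module on sentences: a list of terms (x , I) represents the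
  -- formal sum of the x H_I, terms with the same I being allowed to repeat.
  NSym : Set (c ⊔ a)
  NSym = List (𝕜.Carrier × Sentence A)

  coeff : NSym → Sentence A → 𝕜.Carrier
  coeff []            K = 𝕜.0#
  coeff ((x , I) ∷ f) K with I ≟ K
  ... | yes _ = x 𝕜.+ coeff f K
  ... | no  _ = coeff f K

  -- Elements are equal when their coordinates in the basis (H_I) agree.
  infix 4 _≈_
  _≈_ : Rel NSym (a ⊔ ℓ₁)
  f ≈ g = ∀ K → coeff f K 𝕜.≈ coeff g K

  infixl 6 _+_
  infixl 7 _*_
  infixr 8 _•_

  0# : NSym
  0# = []

  _+_ : NSym → NSym → NSym
  f + g = f ++ g

  _•_ : 𝕜.Carrier → NSym → NSym
  x • f = map (λ (y , I) → x 𝕜.* y , I) f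

  H : Sentence A → NSym
  H I = [ (𝕜.1# , I) ]

  1# : NSym
  1# = H []

  -- The bilinear extension of H_I · H_J = H_{I·J}.
  _*_ : NSym → NSym → NSym
  _*_ = cartesianProductWith λ (x , I) (y , J) → x 𝕜.* y , I ++ J

  -- If J ≼ I then length J ≤ size J = size I, so ∸ is true subtraction here.
  E : Sentence A → NSym
  E I = foldr _+_ 0#
    (map (λ J → ((𝕜.- 𝕜.1#) ^ (size I ∸ length J)) • H J) (refinements I))

  -- The (unital) 𝕜-subalgebra generated by G.
  data ⟨_⟩ (G : Pred NSym p) : Pred NSym (c ⊔ a ⊔ ℓ₁ ⊔ p) where
    generator : ∀ {f} → G f → ⟨ G ⟩ f
    zero      : ⟨ G ⟩ 0#
    one       : ⟨ G ⟩ 1#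
    add       : ∀ {f g} → ⟨ G ⟩ f → ⟨ G ⟩ g → ⟨ G ⟩ (f + g)
    scale     : ∀ x {f} → ⟨ G ⟩ f → ⟨ G ⟩ (x • f)
    multiply  : ∀ {f g} → ⟨ G ⟩ f → ⟨ G ⟩ g → ⟨ G ⟩ (f * g)
    respect   : ∀ {f g} → f ≈ g → ⟨ G ⟩ f → ⟨ G ⟩ g

module Submission where

-- Refining I ++ J amounts to refining I and J independently, so both E I * E J
-- and E (I ++ J) are sums over the same list of pairs of refinements. The signs
-- agree because sizes and lengths are additive under concatenation.

open import Defs
open import Level using (Level)
open import Algebra.Apartness.Bundles using (HeytingField; HeytingCommutativeRing)
open import Algebra.Bundles using (CommutativeRing)
import Algebra.Properties.CommutativeSemigroup as CommutativeSemigroup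
import Algebra.Properties.Semiring.Exp as Exp
open import Data.List.Base
  using (List; []; _∷_; _++_; [_]; map; concat; length; cartesianProductWith)
open import Data.List.NonEmpty.Base as List⁺ using (_∷_)
open import Data.List.Properties
  using (map-id; map-∘; map-cong; map-++; ++-assoc; ++-identityʳ; length-++; length-++-≤ʳ;
         concat-map-[_]; cartesianProductWith-distribʳ-++)
open import Data.List.Relation.Binary.Pointwise as Pointwise using (Pointwise; []; _∷_)
open import Data.List.Relation.Unary.All as All using (All; []; _∷_)
open import Data.Nat.Base using (_∸_; _≤_; z≤n; s≤s) renaming (_+_ to _+ℕ_)
open import Data.Nat.ListAction using (sum)
open import Data.Nat.ListAction.Properties using (sum-++)
open import Data.Nat.Properties
  using (+-mono-≤; +-∸-assoc; +-∸-comm; ∸-+-assoc; ≤-trans; module ≤-Reasoning)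
open import Data.Product.Base using (_×_; ∃-syntax; _,_)
open import Function.Base using (_∘_)
open import Function.Bundles using (Equivalence)
open import Relation.Binary.Core using (REL)
open import Relation.Binary.PropositionalEquality.Core
  using (_≡_; refl; sym; trans; cong; cong₂; subst₂)
open import Relation.Binary.PropositionalEquality.Properties using (module ≡-Reasoning)
open import Relation.Nullary.Decidable using (yes; no)
open import Relation.Unary using (Pred)

private
  variable
    a c p q r ℓ₁ ℓ₂ : Level
    A B C D F : Set a

-- The bounds keep both truncated differences genuine; without them the left side may be larger.
[m∸n]+[o∸p]≡[m+o]∸[n+p] : ∀ {m n o p} → n ≤ m → p ≤ o →
  (m ∸ n) +ℕ (o ∸ p) ≡ (m +ℕ o) ∸ (n +ℕ p)
[m∸n]+[o∸p]≡[m+o]∸[n+p] {m} {n} {o} {p} n≤m p≤o = begin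
  (m ∸ n) +ℕ (o ∸ p)   ≡⟨ +-∸-assoc (m ∸ n) p≤o ⟨
  (m ∸ n) +ℕ o ∸ p     ≡⟨ cong (_∸ p) (+-∸-comm o n≤m) ⟨
  (m +ℕ o) ∸ n ∸ p     ≡⟨ ∸-+-assoc (m +ℕ o) n p ⟩
  (m +ℕ o) ∸ (n +ℕ p)  ∎
  where open ≡-Reasoning

module _ {A : Set a} {f : A → A → A}
         (assoc : ∀ x y z → f (f x y) z ≡ f x (f y z)) where

  private
    prod : List A → List A → List A
    prod = cartesianProductWith f

  cartesianProductWith-mapˡ : ∀ x ys zs → prod (map (f x) ys) zs ≡ map (f x) (prod ys zs)
  cartesianProductWith-mapˡ x []       zs = refl
  cartesianProductWith-mapˡ x (y ∷ ys) zs = begin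
    map (f (f x y)) zs ++ prod (map (f x) ys) zs
      ≡⟨ cong₂ _++_ (map-cong (assoc x y) zs) (cartesianProductWith-mapˡ x ys zs) ⟩
    map (f x ∘ f y) zs ++ map (f x) (prod ys zs)
      ≡⟨ cong (_++ map (f x) (prod ys zs)) (map-∘ zs) ⟩
    map (f x) (map (f y) zs) ++ map (f x) (prod ys zs)
      ≡⟨ map-++ (f x) (map (f y) zs) (prod ys zs) ⟨
    map (f x) (map (f y) zs ++ prod ys zs) ∎
    where open ≡-Reasoning

  -- Both bracketings run through the triples in the same lexicographic order, so the lists are
  -- equal on the nose and not only up to permutation.
  cartesianProductWith-assoc : ∀ xs ys zs → prod (prod xs ys) zs ≡ prod xs (prod ys zs)
  cartesianProductWith-assoc []       ys zs = refl
  cartesianProductWith-assoc (x ∷ xs) ys zs = trans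
    (cartesianProductWith-distribʳ-++ f (map (f x) ys) (prod xs ys) zs)
    (cong₂ _++_ (cartesianProductWith-mapˡ x ys zs) (cartesianProductWith-assoc xs ys zs))

module _ {P : Pred A p} {Q : Pred B q} {R : REL D F r}
         {f : A → B → C} {g : C → F} {h : A → B → D}
         (h∼g∘f : ∀ {x y} → P x → Q y → R (h x y) (g (f x y))) where

  private
    map-pointwise : ∀ {x ys} → P x → All Q ys →
                    Pointwise R (map (h x) ys) (map g (map (f x) ys))
    map-pointwise px []        = []
    map-pointwise px (qy ∷ qs) = h∼g∘f px qy ∷ map-pointwise px qs

  -- The comparison of `h` with `g ∘ f` is asked only on entries satisfying `P` and `Q`, which later
  -- carry the length bounds for the signs.
  cartesianProductWith-pointwise : ∀ {xs ys} → All P xs → All Q ys →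
    Pointwise R (cartesianProductWith h xs ys) (map g (cartesianProductWith f xs ys))
  cartesianProductWith-pointwise []                       qs = []
  cartesianProductWith-pointwise {x ∷ xs} {ys} (px ∷ ps) qs
    rewrite map-++ g (map (f x) ys) (cartesianProductWith f xs ys) =
    Pointwise.++⁺ (map-pointwise px qs) (cartesianProductWith-pointwise ps qs)

cartesianProductWith-map : (h : C → D → F) (s : A → C) (t : B → D) → ∀ xs ys →
  cartesianProductWith h (map s xs) (map t ys) ≡ cartesianProductWith (λ x y → h (s x) (t y)) xs ys
cartesianProductWith-map h s t []       ys = refl
cartesianProductWith-map h s t (x ∷ xs) ys =
  cong₂ _++_ (sym (map-∘ ys)) (cartesianProductWith-map h s t xs ys)

size-++ : ∀ (I J : Sentence A) → size (I ++ J) ≡ size I +ℕ size J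
size-++ I J = trans (cong sum (map-++ List⁺.length I J))
                    (sum-++ (map List⁺.length I) (map List⁺.length J))

-- `refinements` is an iterated product of the factorisations of the single words, so splitting it
-- after `I` is a matter of reassociating.
refinements-++ : ∀ (I J : Sentence A) →
  refinements (I ++ J) ≡ cartesianProductWith _++_ (refinements I) (refinements J)
refinements-++ []             J = sym (trans (++-identityʳ _) (map-id (refinements J)))
refinements-++ ((x ∷ xs) ∷ I) J = trans
  (cong (cartesianProductWith _++_ (factorisations x xs)) (refinements-++ I J))
  (sym (cartesianProductWith-assoc ++-assoc (factorisations x xs) (refinements I) (refinements J)))

-- Words are non-empty: the head letter of `v` accounts for `v`, and its tail only adds letters.
length≤length-concat : ∀ (J : Sentence A) → length J ≤ length (concat (map List⁺.toList J))
length≤length-concat []      = z≤n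
length≤length-concat (v ∷ J) =
  s≤s (≤-trans (length≤length-concat J) (length-++-≤ʳ _ {List⁺.tail v}))

≼⇒length≤size : ∀ {I J : Sentence A} → J ≼ I → length J ≤ size I
≼⇒length≤size ([]    , refl , refl) = z≤n
≼⇒length≤size (k ∷ K , refl , refl) = begin
  length (List⁺.toList k ++ concat (map List⁺.toList K))
    ≡⟨ length-++ (List⁺.toList k) ⟩
  List⁺.length k +ℕ length (concat (map List⁺.toList K))
    -- The block `k` merges into one word of the coarser sentence, whose length unfolds to the
    -- number of letters in `k`.
    ≤⟨ +-mono-≤ (length≤length-concat (List⁺.toList k)) (≼⇒length≤size (K , refl , refl)) ⟩
  List⁺.length (List⁺.concat k) +ℕ size (map List⁺.concat K) ∎
  where open ≤-Reasoning

refinements-length≤size : ∀ (I : Sentence A) → All (λ J → length J ≤ size I) (refinements I)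
refinements-length≤size I = All.tabulate (≼⇒length≤size ∘ Equivalence.to (∈-refinements {I = I}))

module _ (𝕜 : HeytingField c ℓ₁ ℓ₂) (A : Set a) (finite : Finite A) where

  private
    module 𝕜 where
      open CommutativeRing
        (HeytingCommutativeRing.commutativeRing (HeytingField.heytingCommutativeRing 𝕜)) public
      open Exp semiring public using (_^_; ^-homo-*)
      open CommutativeSemigroup *-commutativeSemigroup public using (interchange)

  open NSym 𝕜 A finite

  infix 4 _∼_
  -- Field laws hold only up to `𝕜.≈`, so lists of terms are compared entrywise rather than by `≡`.
  _∼_ : 𝕜.Carrier × Sentence A → 𝕜.Carrier × Sentence A → Set _
  (x , I) ∼ (y , J) = x 𝕜.≈ y × I ≡ J

  -- Related terms carry the same sentence, so the test against `K` takes the same branch in both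
  -- coefficients.
  pointwise⇒≈ : ∀ {f g} → Pointwise _∼_ f g → f ≈ g
  pointwise⇒≈ []                              K = 𝕜.refl
  pointwise⇒≈ (_∷_ {x = _ , I} (x≈y , refl) f∼g) K with I ≟ K
  ... | yes _ = 𝕜.+-cong x≈y (pointwise⇒≈ f∼g K)
  ... | no  _ = pointwise⇒≈ f∼g K

  sign : Sentence A → Sentence A → 𝕜.Carrier
  sign I J = (𝕜.- 𝕜.1#) 𝕜.^ (size I ∸ length J)

  -- The factor 1# is the coefficient in H J.
  term : Sentence A → Sentence A → 𝕜.Carrier × Sentence A
  term I J = sign I J 𝕜.* 𝕜.1# , J

  -- The sum in `E` is a `concat`, and each summand is a one-term list.
  E≡terms : ∀ I → E I ≡ map (term I) (refinements I)
  E≡terms I = trans (cong concat (map-∘ (refinements I))) (concat-map-[ _ ])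

  sign-++ : ∀ I J I′ J′ → length I′ ≤ size I → length J′ ≤ size J →
            sign I I′ 𝕜.* sign J J′ 𝕜.≈ sign (I ++ J) (I′ ++ J′)
  sign-++ I J I′ J′ ≤I ≤J = 𝕜.trans
    (𝕜.sym (𝕜.^-homo-* (𝕜.- 𝕜.1#) (size I ∸ length I′) (size J ∸ length J′)))
    (𝕜.reflexive (cong ((𝕜.- 𝕜.1#) 𝕜.^_) (trans
      ([m∸n]+[o∸p]≡[m+o]∸[n+p] ≤I ≤J)
      (sym (cong₂ _∸_ (size-++ I J) (length-++ I′))))))

  E-* : ∀ I J → E I * E J ≈ E (I ++ J)
  -- Both sides become lists of terms indexed by the same pairs of refinements, in the same order.
  E-* I J = pointwise⇒≈ (subst₂ (Pointwise _∼_)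
    (sym (trans (cong₂ _*_ (E≡terms I) (E≡terms J))
                (cartesianProductWith-map _ (term I) (term J) (refinements I) (refinements J))))
    (sym (trans (E≡terms (I ++ J)) (cong (map (term (I ++ J))) (refinements-++ I J))))
    (cartesianProductWith-pointwise
      -- The coefficient `(s * 1#) * (t * 1#)` is regrouped as `(s * t) * (1# * 1#)`, which
      -- separates the signs from the units.
      (λ {I′} {J′} ≤I ≤J → 𝕜.trans (𝕜.interchange _ _ _ _)
                   (𝕜.*-cong (sign-++ I J I′ J′ ≤I ≤J) (𝕜.*-identityˡ 𝕜.1#)) , refl)
      (refinements-length≤size I) (refinements-length≤size J)))

  -- Induction on the words: `w ∷ I` is `[ w ] ++ I` by definition, so `E-*` splits off a generator.
  E-generated : ∀ I → ⟨ (λ f → ∃[ w ] f ≡ E [ w ]) ⟩ (E I)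
  E-generated []      =
    -- The only term of `E []` has coefficient `1# * 1#`, the first factor being the zeroth power of
    -- -1.
    respect (pointwise⇒≈ {1#} {E []} ((𝕜.sym (𝕜.*-identityˡ 𝕜.1#) , refl) ∷ [])) one
  E-generated (w ∷ I) =
    respect (E-* [ w ] I) (multiply (generator (w , refl)) (E-generated I))

proposition3p8 : ∀ {c ℓ₁ ℓ₂ a : Level}
    (𝕜 : HeytingField c ℓ₁ ℓ₂) → CharacteristicZero 𝕜 →
    (A : Set a) (finite : Finite A) →
    let open NSym 𝕜 A finite in
    (∀ (I J : Sentence A) → E I * E J ≈ E (I ++ J)) ×
    (∀ (I : Sentence A) → ⟨ (λ f → ∃[ w ] f ≡ E [ w ]) ⟩ (E I))
proposition3p8 𝕜 _ A finite = E-* 𝕜 A finite , E-generated 𝕜 A finite
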